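{- Let $G_W=(V,E_W)$ be a temporal graph over a window $W$ of consecutive integer timestamps, let $\alpha\in[0,1]$, and let $G'=(V',E',\ell)$ be its transformed static directed weighted graph. Then for every pair of distinct vertices $u,v\in V$, the length of a shortest path in $G'$ from any replica of $u$ to any replica of $v$ equals the shortest-fastest-path distance from $u$ to $v$ in $G_W$. That is, $$d_{G_W}(u,v)=\min_{t_i,t_j\in W}\ \min\{\ell(p) : p \text{ is a directed path in } G' \text{ from } (u,t_i) \text{ to } (v,t_j)\},$$ where both sides are $\infty$ if no such path exists.
   Context: A temporal graph $G_W=(V,E_W)$ consists of a finite vertex set $V$, a window $W$ of finitely many consecutive integer timestamps, and a finite set $E_W$ of undirected timestamped edges $(u,v,t)$ with $u,v\in V$, $u\neq v$, $t\in W$. A temporal path from $u$ to $v$ is a sequence of edges $p=\{(u=v_0,v_1,t_0),(v_1,v_2,t_1),\ldots,(v_n,v_{n+1}=v,t_n)\}$ of the temporal graph (each undirected edge may be traversed in either direction) with $t_{i-1}\le t_i$ for all $1\le i\le n$. Its number of edges is denoted $|p|$. Its cost is $\mathcal{L}(p)=\alpha|p|+(1-\alpha)(t_n-t_0)$. The shortest-fastest-path distance $d_{G_W}(u,v)$ is the minimum of $\mathcal{L}(p)$ over all temporal paths $p$ from $u$ to $v$ in $G_W$, and it is $\infty$ if there is none. The transformed graph $G'=(V',E',\ell)$, with edge weights $\ell:E'\to[0,1]$, is defined as follows. Its vertex set is $V'=\{(v,t): v\in V,\ t\in W\}$; the vertices $(v,t)$, $t\in W$, are called the replicas of $v$. For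 each $v\in V$ and each pair of consecutive timestamps $t,t+1\in W$ there is a directed edge from $(v,t)$ to $(v,t+1)$ of weight $1-\alpha$. For each $(u,v,t)\in E_W$ there are directed edges from $(u,t)$ to $(v,t)$ and from $(v,t)$ to $(u,t)$, each of weight $\alpha$. The length $\ell(p)$ of a directed path $p$ in $G'$ is the sum of the weights of its edges. -}

module Defs where

open import Algebra.Bundles using (CommutativeRing)
open import Data.Fin.Base using (Fin; toℕ)
open import Data.Integer.Base as ℤ using (ℤ)
open import Data.Nat.Base as ℕ using (ℕ; zero; suc)
open import Data.Product.Base using (_×_; _,_; ∃; ∃-syntax; uncurry)
open import Data.Sum.Base using (_⊎_; inj₁; inj₂)
open import Level using (Level; _⊔_; 0ℓ) renaming (suc to lsuc)
open import Relation.Binary.Bundles using (TotalOrder)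
open import Relation.Binary.Construct.Closure.ReflexiveTransitive
  using (Star; ε; _◅_)
open import Relation.Binary.Core using (Rel)
open import Relation.Binary.PropositionalEquality.Core using (_≡_; refl)
open import Relation.Binary.Structures using (IsTotalOrder)
open import Relation.Nullary.Construct.Add.Supremum using (_⁺; [_]; ⊤⁺)
open import Relation.Nullary.Decidable.Core using (Dec)
open import Relation.Nullary.Negation.Core using (¬_)
import Relation.Binary.Reasoning.PartialOrder as PosetReasoning
import Relation.Binary.Construct.Add.Supremum.Equality as SupEquality
import Relation.Binary.Construct.Add.Supremum.NonStrict as SupOrder

-- The standard library has no real numbers.  The parameter α and all costs
-- are taken in an arbitrary totally ordered commutative ring; ℝ and ℚ are the
-- intended instances.

record OrderedCommutativeRing (c ℓ₁ ℓ₂ : Level) : Set (lsuc (c ⊔ ℓ₁ ⊔ ℓ₂)) where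
  infix 4 _≤_
  field
    commutativeRing : CommutativeRing c ℓ₁
  open CommutativeRing commutativeRing public
  field
    _≤_          : Rel Carrier ℓ₂
    isTotalOrder : IsTotalOrder _≈_ _≤_
    +-monoʳ-≤    : ∀ z {x y} → x ≤ y → z + x ≤ z + y
    *-nonneg     : ∀ {x y} → 0# ≤ x → 0# ≤ y → 0# ≤ x * y

  totalOrder : TotalOrder c ℓ₁ ℓ₂
  totalOrder = record { isTotalOrder = isTotalOrder }

  open SupEquality _≈_ public using (_≈⁺_)
  open SupOrder _≤_ public using (_≤⁺_)

  fromℕ : ℕ → Carrier
  fromℕ zero    = 0#
  fromℕ (suc n) = 1# + fromℕ n

  fromℤ : ℤ → Carrier
  fromℤ (ℤ.+ n)      = fromℕ n
  fromℤ (ℤ.-[1+ n ]) = - fromℕ (suc n)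

  -- m is the minimum of the values f i, with the convention min ∅ = ∞.
  record IsMinimum {a} {I : Set a} (f : I → Carrier ⁺) (m : Carrier ⁺)
                   : Set (a ⊔ c ⊔ ℓ₁ ⊔ ℓ₂) where
    field
      lowerBound : ∀ i → m ≤⁺ f i
      attained   : (∃[ i ] f i ≈⁺ m) ⊎ (¬ I × m ≡ ⊤⁺)

  -- Minima are unique, so "∃ d, d is the minimum of f and of g" says that the
  -- two minima exist and are equal.
  minimum-unique : ∀ {a} {I : Set a} {f : I → Carrier ⁺} {m m′} →
                   IsMinimum f m → IsMinimum f m′ → m ≈⁺ m′
  minimum-unique {f = f} p q = SupOrder.≤⁺-antisym _≤_ Order.antisym (below p q) (below q p)
    where
    open IsMinimum
    module Order = IsTotalOrder isTotalOrder

    ≤⁺-respʳ-≈⁺ : ∀ {x y z} → x ≤⁺ y → y ≈⁺ z → x ≤⁺ z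
    ≤⁺-respʳ-≈⁺ SupOrder.[ x≤y ] SupEquality.[ y≈z ] = SupOrder.[ Order.trans x≤y (Order.reflexive y≈z) ]
    ≤⁺-respʳ-≈⁺ (x SupOrder.≤⊤⁺) SupEquality.⊤⁺≈⊤⁺ = x SupOrder.≤⊤⁺

    below : ∀ {m m′} → IsMinimum f m → IsMinimum f m′ → m ≤⁺ m′
    below p q with attained q
    ... | inj₁ (i , fi≈m′) = ≤⁺-respʳ-≈⁺ (lowerBound p i) fi≈m′
    ... | inj₂ (_ , refl)  = _ SupOrder.≤⊤⁺

-- The timestamps start, start + 1, …, start + (size - 1).

record Window : Set where
  field
    start : ℤ
    size  : ℕ

  Timestamp : Set
  Timestamp = Fin size

  time : Timestamp → ℤ
  time i = start ℤ.+ ℤ.+ toℕ i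

-- Temporal graphs on the vertex set Fin n.  Undirected edges are given by a
-- symmetric relation; since Fin n and the window are finite, decidability
-- makes the edge set finite.

record TemporalGraph (n : ℕ) (W : Window) : Set₁ where
  open Window W public

  Vertex : Set
  Vertex = Fin n

  field
    Edge        : Vertex → Vertex → Timestamp → Set
    edge?       : ∀ u v t → Dec (Edge u v t)
    symmetric   : ∀ {u v t} → Edge u v t → Edge v u t
    irreflexive : ∀ {v t} → ¬ Edge v v t

  -- TemporalPath u v s t: temporal paths from u to v whose first edge has
  -- timestamp s and whose last edge has timestamp t.
  data TemporalPath : Vertex → Vertex → Timestamp → Timestamp → Set where
    last : ∀ {u v t} → Edge u v t → TemporalPath u v t t
    cons : ∀ {u v w r s t} → Edge u v r → time r ℤ.≤ time s →
           TemporalPath v w s t → TemporalPath u w r t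

  ∣_∣ : ∀ {u v s t} → TemporalPath u v s t → ℕ
  ∣ last _ ∣     = 1
  ∣ cons _ _ p ∣ = suc ∣ p ∣

  Replica : Set
  Replica = Vertex × Timestamp

  data TEdge : Rel Replica 0ℓ where
    wait : ∀ v {s t} → time t ≡ time s ℤ.+ ℤ.1ℤ → TEdge (v , s) (v , t)
    move : ∀ {u v t} → Edge u v t → TEdge (u , t) (v , t)

  TPath : Rel Replica 0ℓ
  TPath = Star TEdge

module Distances {c ℓ₁ ℓ₂} (R : OrderedCommutativeRing c ℓ₁ ℓ₂)
                 (α : OrderedCommutativeRing.Carrier R)
                 {n : ℕ} {W : Window} (G : TemporalGraph n W) where

  open OrderedCommutativeRing R
  open TemporalGraph G
  open PosetReasoning (TotalOrder.poset totalOrder)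

  cost : ∀ {u v s t} → TemporalPath u v s t → Carrier
  cost {s = s} {t = t} p =
    α * fromℕ ∣ p ∣ + (1# - α) * fromℤ (time t ℤ.- time s)

  IsShortestFastestDistance : Vertex → Vertex → Carrier ⁺ → Set (c ⊔ ℓ₁ ⊔ ℓ₂)
  IsShortestFastestDistance u v =
    IsMinimum {I = ∃[ s ] ∃[ t ] TemporalPath u v s t} (λ (_ , _ , p) → [ cost p ])

  weight : ∀ {x y} → TEdge x y → Carrier
  weight (wait _ _) = 1# - α
  weight (move _)   = α

  weight-nonneg : 0# ≤ α → α ≤ 1# → ∀ {x y} (e : TEdge x y) → 0# ≤ weight e
  weight-nonneg 0≤α α≤1 (move _)   = 0≤α
  weight-nonneg 0≤α α≤1 (wait _ _) = begin
    0#       ≈⟨ -‿inverseˡ α ⟨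
    - α + α  ≤⟨ +-monoʳ-≤ (- α) α≤1 ⟩
    - α + 1# ≈⟨ +-comm (- α) 1# ⟩
    1# - α   ∎

  weight-≤1 : 0# ≤ α → α ≤ 1# → ∀ {x y} (e : TEdge x y) → weight e ≤ 1#
  weight-≤1 0≤α α≤1 (move _)   = α≤1
  weight-≤1 0≤α α≤1 (wait _ _) = begin
    1# - α             ≈⟨ +-identityʳ (1# - α) ⟨
    1# - α + 0#        ≤⟨ +-monoʳ-≤ (1# - α) 0≤α ⟩
    1# - α + α         ≈⟨ +-assoc 1# (- α) α ⟩
    1# + (- α + α)     ≈⟨ +-congˡ (-‿inverseˡ α) ⟩
    1# + 0#            ≈⟨ +-identityʳ 1# ⟩
    1#                 ∎

  pathLength : ∀ {x y} → TPath x y → Carrier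
  pathLength ε       = 0#
  pathLength (e ◅ p) = weight e + pathLength p

  IsShortestPathLength : Replica → Replica → Carrier ⁺ → Set (c ⊔ ℓ₁ ⊔ ℓ₂)
  IsShortestPathLength x y =
    IsMinimum {I = TPath x y} (λ p → [ pathLength p ])

  -- min over tᵢ, tⱼ of the shortest path length from (u , tᵢ) to (v , tⱼ);
  -- m tᵢ tⱼ is the inner minimum.
  IsReplicaDistance : Vertex → Vertex → Carrier ⁺ → Set (c ⊔ ℓ₁ ⊔ ℓ₂)
  IsReplicaDistance u v d =
    ∃[ m ] (∀ tᵢ tⱼ → IsShortestPathLength (u , tᵢ) (v , tⱼ) (m tᵢ tⱼ))
         × IsMinimum (uncurry m) d

{-# OPTIONS --safe #-}

-- Contracting the waits of a directed path in G′ between replicas of distinct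
-- vertices gives a temporal path with the same moves, whose duration is at most
-- the number of waits; conversely a temporal path is lifted to G′ by inserting
-- exactly the waits it needs, at equal cost.  So both sides have the same lower
-- bounds.  Constructively the minima also have to be exhibited: shortest paths
-- in G′ come from the Floyd–Warshall recursion, which needs only that weights
-- are nonnegative and the order is total.

module Submission where

open import Defs
open import Data.Empty using (⊥-elim)
open import Data.Fin.Base using (Fin; zero; suc; toℕ; fromℕ<; combine; remQuot)
import Data.Fin.Properties as Fin
import Data.Integer.Base as ℤ
import Data.Integer.Properties as ℤ
open import Data.List.Base using (List; []; _∷_; allFin; cartesianProduct)
open import Data.List.Membership.Propositional using (_∈_)
open import Data.List.Membership.Propositional.Properties
  using (∈-allFin; ∈-cartesianProduct⁺)
open import Data.List.Relation.Unary.Any using (here; there)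
open import Data.Maybe.Base as Maybe using (Maybe; just; nothing)
open import Data.Maybe.Relation.Unary.Any as Any using (Any; just)
open import Data.Nat.Base as ℕ using (ℕ; zero; suc)
import Data.Nat.Properties as ℕ
open import Data.Product.Base using (Σ; _×_; _,_; ∃-syntax; uncurry; proj₁; proj₂)
open import Data.Product.Properties using (≡-dec)
open import Data.Sum.Base using (_⊎_; inj₁; inj₂; [_,_]′)
open import Level using (_⊔_)
open import Relation.Binary.Construct.Closure.ReflexiveTransitive
  using (Star; ε; _◅_; _◅◅_)
open import Relation.Binary.Core using (Rel)
open import Relation.Binary.Bundles using (TotalOrder)
open import Relation.Binary.Definitions using (DecidableEquality)
open import Relation.Binary.PropositionalEquality.Core as ≡ using (_≡_; _≢_)
open import Relation.Binary.PropositionalEquality.Properties using (module ≡-Reasoning)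
open import Relation.Binary.Structures using (IsTotalOrder)
import Relation.Binary.Construct.Add.Supremum.Equality as SupEquality
import Relation.Binary.Construct.Add.Supremum.NonStrict as SupOrder
import Relation.Binary.Reasoning.PartialOrder as PosetReasoning
open import Relation.Nullary.Construct.Add.Supremum using (_⁺; [_]; ⊤⁺)
open import Relation.Nullary.Decidable.Core using (yes; no)
open import Relation.Nullary.Negation.Core using (¬_)
import Algebra.Properties.Group as GroupProperties
open import Algebra.Bundles using (module AbelianGroup)

-- Order and addition in an ordered commutative ring.

module OrderedRingProperties {c ℓ₁ ℓ₂} (R : OrderedCommutativeRing c ℓ₁ ℓ₂) where

  open OrderedCommutativeRing R hiding (zero)
  open IsTotalOrder isTotalOrder public
    using (total; antisym)
    renaming (refl to ≤-refl; reflexive to ≤-reflexive; trans to ≤-trans)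
  open PosetReasoning (TotalOrder.poset totalOrder)

  +-monoˡ-≤ : ∀ z {x y} → x ≤ y → x + z ≤ y + z
  +-monoˡ-≤ z {x} {y} x≤y = begin
    x + z ≈⟨ +-comm x z ⟩
    z + x ≤⟨ +-monoʳ-≤ z x≤y ⟩
    z + y ≈⟨ +-comm z y ⟩
    y + z ∎

  +-mono-≤ : ∀ {x y z w} → x ≤ y → z ≤ w → x + z ≤ y + w
  +-mono-≤ x≤y z≤w = ≤-trans (+-monoˡ-≤ _ x≤y) (+-monoʳ-≤ _ z≤w)

  x≤x+y : ∀ x {y} → 0# ≤ y → x ≤ x + y
  x≤x+y x 0≤y = ≤-trans (≤-reflexive (sym (+-identityʳ x))) (+-monoʳ-≤ x 0≤y)

  x≤y+x : ∀ x {y} → 0# ≤ y → x ≤ y + x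
  x≤y+x x {y} 0≤y = ≤-trans (x≤x+y x 0≤y) (≤-reflexive (+-comm x y))

  +-nonneg : ∀ {x y} → 0# ≤ x → 0# ≤ y → 0# ≤ x + y
  +-nonneg 0≤x 0≤y = ≤-trans 0≤x (x≤x+y _ 0≤y)

-- Minima of families with values in the carrier extended by infinity.

module Minimum {c ℓ₁ ℓ₂} (R : OrderedCommutativeRing c ℓ₁ ℓ₂) where

  open OrderedCommutativeRing R hiding (zero)
  open OrderedRingProperties R
  open SupOrder _≤_ using ([_]; _≤⊤⁺) public
  open SupEquality _≈_ using ([_]; ⊤⁺≈⊤⁺; ≈⁺-refl)

  ≤⁺-trans : ∀ {x y z} → x ≤⁺ y → y ≤⁺ z → x ≤⁺ z
  ≤⁺-trans = SupOrder.≤⁺-trans _≤_ ≤-trans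

  ≤⁺-refl : ∀ {x} → x ≤⁺ x
  ≤⁺-refl = SupOrder.≤⁺-reflexive-≡ _≤_ (λ where ≡.refl → ≤-refl) ≡.refl

  -- If `m` is infinite, any index would put `⊤⁺` below a finite value, so the index type is empty.
  -- If `m` is finite, one inequality at a witness suffices, because the lower bound supplies the
  -- other.
  finite-isMinimum : ∀ {i} {I : Set i} {g : I → Carrier} {m} →
                    (∀ i → m ≤⁺ [ g i ]) →
                    m ≡ ⊤⁺ ⊎ (∃[ i ] [ g i ] ≤⁺ m) →
                    IsMinimum (λ i → [ g i ]) m
  finite-isMinimum {I = I} {m = m} lb att = record
    { lowerBound = lb
    ; attained   = attained att
    }
    where
    attained : _ → _
    attained (inj₂ (i , gi≤m)) = inj₁ (i , SupOrder.≤⁺-antisym _≤_ antisym gi≤m (lb i))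
    attained (inj₁ m≡⊤)        = inj₂ ((λ i → ⊤≰ m≡⊤ (lb i)) , m≡⊤)
      where
      ⊤≰ : ∀ {x} → m ≡ ⊤⁺ → ¬ m ≤⁺ [ x ]
      ⊤≰ ≡.refl ()

  finiteMinimum : ∀ {n} (f : Fin n → Carrier ⁺) → ∃[ m ] IsMinimum f m
  finiteMinimum {zero}  f = ⊤⁺ , record
    { lowerBound = λ ()
    ; attained   = inj₂ ((λ ()) , ≡.refl)
    }
  finiteMinimum {suc n} f with finiteMinimum (λ i → f (suc i))
  ... | m , isMin with SupOrder.≤⁺-total _≤_ total (f zero) m
  ...   | inj₁ f0≤m = f zero , record
    { lowerBound = λ where
        zero    → ≤⁺-refl
        (suc i) → ≤⁺-trans f0≤m (lowerBound i)
    ; attained   = inj₁ (zero , ≈⁺-refl refl)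
    }
    where open IsMinimum isMin
  ...   | inj₂ m≤f0 = m , record
    { lowerBound = λ where
        zero    → m≤f0
        (suc i) → lowerBound i
    ; attained   = inj₁ (attained′ attained m≤f0)
    }
    where
    open IsMinimum isMin
    attained′ : ∀ {m} → (∃[ i ] f (suc i) ≈⁺ m) ⊎ (¬ Fin n × m ≡ ⊤⁺) →
                m ≤⁺ f zero → ∃[ i ] f i ≈⁺ m
    attained′ (inj₁ (i , fi≈m)) _ = suc i , fi≈m
    -- The tail family is empty but the whole family is not, so the value `⊤⁺` must be attained: it
    -- lies below `f zero`, which is therefore infinite too.
    attained′ (inj₂ (_ , ≡.refl)) ⊤≤f0 = zero , ⊤≤⇒≈⊤ ⊤≤f0
      where
      ⊤≤⇒≈⊤ : ∀ {x} → ⊤⁺ ≤⁺ x → x ≈⁺ ⊤⁺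
      ⊤≤⇒≈⊤ (_ ≤⊤⁺) = ⊤⁺≈⊤⁺

  -- A surjection `g` with section `h` preserves the set of values, and `h` carries emptiness of `I`
  -- over to `J`.
  isMinimum-reindex : ∀ {i j} {I : Set i} {J : Set j} {f : J → Carrier ⁺} {m}
                      (g : I → J) (h : J → I) → (∀ j → g (h j) ≡ j) →
                      IsMinimum (λ i → f (g i)) m → IsMinimum f m
  isMinimum-reindex {f = f} g h gh isMin = record
    { lowerBound = λ j → ≡.subst (λ j → _ ≤⁺ f j) (gh j) (lowerBound (h j))
    ; attained   = [ (λ (i , eq) → inj₁ (g i , eq))
                   , (λ (¬I , m≡⊤) → inj₂ ((λ j → ¬I (h j)) , m≡⊤)) ]′ attained
    }
    where open IsMinimum isMin

  finiteMinimum₂ : ∀ {m n} (f : Fin m × Fin n → Carrier ⁺) → ∃[ d ] IsMinimum f d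
  finiteMinimum₂ {m} {n} f with finiteMinimum (λ i → f (remQuot {m} n i))
  ... | d , isMin = d , isMinimum-reindex (remQuot n) (uncurry combine)
                          (λ (i , j) → Fin.remQuot-combine i j) isMin

-- Shortest paths in a finite graph with nonnegative weights, by Floyd-Warshall.

module ShortestPaths {c ℓ₁ ℓ₂} (R : OrderedCommutativeRing c ℓ₁ ℓ₂) where

  open OrderedCommutativeRing R hiding (zero)
  open OrderedRingProperties R

  module FloydWarshall
    {a e} {X : Set a} (_≟_ : DecidableEquality X) {E : Rel X e}
    (weight : ∀ {x y} → E x y → Carrier)
    (weight-nonneg : ∀ {x y} (e : E x y) → 0# ≤ weight e)
    (lightestEdge : ∀ x y → (Σ (E x y) λ e → ∀ (e′ : E x y) → weight e ≤ weight e′) ⊎ ¬ E x y)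
    (vertices : List X) (∈-vertices : ∀ x → x ∈ vertices)
    where

    length : ∀ {x y} → Star E x y → Carrier
    length ε       = 0#
    length (e ◅ p) = weight e + length p

    length-nonneg : ∀ {x y} (p : Star E x y) → 0# ≤ length p
    length-nonneg ε       = ≤-refl
    length-nonneg (e ◅ p) = +-nonneg (weight-nonneg e) (length-nonneg p)

    length-◅◅ : ∀ {x y z} (p : Star E x y) (q : Star E y z) →
                length (p ◅◅ q) ≈ length p + length q
    length-◅◅ ε       q = sym (+-identityˡ _)
    length-◅◅ (e ◅ p) q = trans (+-congˡ (length-◅◅ p q)) (sym (+-assoc _ _ _))

    infix 4 _≼_
    -- An absent path counts as infinitely long: `Any` demands that a path be present. Bounds thus
    -- stay in the carrier, and no addition on the extended carrier is required.
    _≼_ : ∀ {x y} → Maybe (Star E x y) → Carrier → Set _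
    m ≼ b = Any (λ p → length p ≤ b) m

    ≼-trans : ∀ {x y} {m : Maybe (Star E x y)} {b b′} → m ≼ b → b ≤ b′ → m ≼ b′
    ≼-trans m≼b b≤b′ = Any.map (λ p≤b → ≤-trans p≤b b≤b′) m≼b

    ≼-nonneg : ∀ {x y} {m : Maybe (Star E x y)} {b} → m ≼ b → 0# ≤ b
    ≼-nonneg (just {p} p≤b) = ≤-trans (length-nonneg p) p≤b

    shorter : ∀ {x y} (m m′ : Maybe (Star E x y)) → Maybe (Star E x y)
    shorter nothing  m′       = m′
    shorter (just p) nothing  = just p
    shorter (just p) (just q) with total (length p) (length q)
    ... | inj₁ _ = just p
    ... | inj₂ _ = just q

    shorter-≼ˡ : ∀ {x y} (m m′ : Maybe (Star E x y)) {b} → m ≼ b → shorter m m′ ≼ b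
    shorter-≼ˡ (just p) nothing  p≼b = p≼b
    shorter-≼ˡ (just p) (just q) (just p≤b) with total (length p) (length q)
    ... | inj₁ _   = just p≤b
    ... | inj₂ q≤p = just (≤-trans q≤p p≤b)

    shorter-≼ʳ : ∀ {x y} (m m′ : Maybe (Star E x y)) {b} → m′ ≼ b → shorter m m′ ≼ b
    shorter-≼ʳ nothing  m′       q≼b = q≼b
    shorter-≼ʳ (just p) (just q) (just q≤b) with total (length p) (length q)
    ... | inj₁ p≤q = just (≤-trans p≤q q≤b)
    ... | inj₂ _   = just q≤b

    shorter-≼⁻ : ∀ {x y} (m m′ : Maybe (Star E x y)) {b} →
                 shorter m m′ ≼ b → m ≼ b ⊎ m′ ≼ b
    shorter-≼⁻ nothing  m′       r≼b = inj₂ r≼b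
    shorter-≼⁻ (just p) nothing  r≼b = inj₁ r≼b
    shorter-≼⁻ (just p) (just q) r≼b with total (length p) (length q)
    ... | inj₁ _ = inj₁ r≼b
    ... | inj₂ _ = inj₂ r≼b

    join : ∀ {x y z} → Maybe (Star E x y) → Maybe (Star E y z) → Maybe (Star E x z)
    join m m′ = Maybe.ap (Maybe.map _◅◅_ m) m′

    join-≼ : ∀ {x y z} {m : Maybe (Star E x y)} {m′ : Maybe (Star E y z)} {b b′} →
             m ≼ b → m′ ≼ b′ → join m m′ ≼ b + b′
    join-≼ (just {p} p≤b) (just {q} q≤b′) =
      just (≤-trans (≤-reflexive (length-◅◅ p q)) (+-mono-≤ p≤b q≤b′))

    join-≼⁻ : ∀ {x y z} (m : Maybe (Star E x y)) (m′ : Maybe (Star E y z)) {b} →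
              join m m′ ≼ b → ∃[ b₁ ] ∃[ b₂ ] m ≼ b₁ × m′ ≼ b₂ × b₁ + b₂ ≤ b
    join-≼⁻ (just p) (just q) (just pq≤b) =
      length p , length q , just ≤-refl , just ≤-refl ,
      ≤-trans (≤-reflexive (sym (length-◅◅ p q))) pq≤b

    -- The state of Floyd–Warshall once the vertices in S have been processed.
    -- Optimality among paths with interior in S is replaced by the triangle
    -- inequality through S, so that paths never have to be split.
    record Stage (S : List X) : Set (a ⊔ e ⊔ c ⊔ ℓ₂) where
      field
        best      : ∀ x y → Maybe (Star E x y)
        best-ε    : ∀ x → best x x ≼ 0#
        best-edge : ∀ {x y} (e : E x y) → best x y ≼ weight e
        best-via  : ∀ {x k y b b′} → k ∈ S → best x k ≼ b → best k y ≼ b′ →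
                    best x y ≼ b + b′

    initial : Stage []
    initial = record
      { best      = λ x y → proj₁ (direct x y)
      ; best-ε    = λ x → proj₁ (proj₂ (direct x x)) ≡.refl
      ; best-edge = λ {x} {y} → proj₂ (proj₂ (direct x y))
      ; best-via  = λ ()
      }
      where
      direct : ∀ x y → Σ (Maybe (Star E x y)) λ m →
               (x ≡ y → m ≼ 0#) × (∀ e → m ≼ weight e)
      direct x y with x ≟ y
      -- On the diagonal the empty path is at least as good as any loop, since weights are
      -- nonnegative.
      ... | yes ≡.refl = just ε , (λ _ → just ≤-refl) , (λ e → just (weight-nonneg e))
      ... | no x≢y with lightestEdge x y
      ...   | inj₁ (e₀ , e₀≤) = just (e₀ ◅ ε) , (λ x≡y → ⊥-elim (x≢y x≡y)) ,
              (λ e → just (≤-trans (≤-reflexive (+-identityʳ _)) (e₀≤ e)))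
      ...   | inj₂ ¬e = nothing , (λ x≡y → ⊥-elim (x≢y x≡y)) , (λ e → ⊥-elim (¬e e))

    step : ∀ k {S} → Stage S → Stage (k ∷ S)
    step k {S} stage = record
      { best      = best′
      ; best-ε    = λ x → keep (best-ε x)
      ; best-edge = λ e → keep (best-edge e)
      ; best-via  = via
      }
      where
      open Stage stage

      best′ : ∀ x y → Maybe (Star E x y)
      best′ x y = shorter (best x y) (join (best x k) (best k y))

      keep : ∀ {x y b} → best x y ≼ b → best′ x y ≼ b
      keep = shorter-≼ˡ _ _

      through-k : ∀ {x y b b₁ b₂} → best x k ≼ b₁ → best k y ≼ b₂ → b₁ + b₂ ≤ b →
                  best′ x y ≼ b
      through-k {x} {y} xk ky b₁+b₂≤b = ≼-trans (shorter-≼ʳ (best x y) _ (join-≼ xk ky)) b₁+b₂≤b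

      best′-≼⁻ : ∀ {x y b} → best′ x y ≼ b →
                 best x y ≼ b ⊎
                 (∃[ b₁ ] ∃[ b₂ ] best x k ≼ b₁ × best k y ≼ b₂ × b₁ + b₂ ≤ b)
      best′-≼⁻ {x} {y} xy with shorter-≼⁻ (best x y) _ xy
      ... | inj₁ xy₀ = inj₁ xy₀
      ... | inj₂ xky = inj₂ (join-≼⁻ (best x k) (best k y) xky)

      -- A candidate that passes through `k` on its way to `k` ends in a closed walk at `k`. Its
      -- length is nonnegative, so cutting it off keeps the bound. Hence processing `k` does not
      -- improve entries that end in `k`; `out-of-k` is the mirror image.
      into-k : ∀ {x b} → best′ x k ≼ b → best x k ≼ b
      into-k xk with best′-≼⁻ xk
      ... | inj₁ xk₀ = xk₀
      ... | inj₂ (_ , _ , xk₀ , kk , sum≤b) =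
        ≼-trans xk₀ (≤-trans (x≤x+y _ (≼-nonneg kk)) sum≤b)

      out-of-k : ∀ {y b} → best′ k y ≼ b → best k y ≼ b
      out-of-k ky with best′-≼⁻ ky
      ... | inj₁ ky₀ = ky₀
      ... | inj₂ (_ , _ , kk , ky₀ , sum≤b) =
        ≼-trans ky₀ (≤-trans (x≤y+x _ (≼-nonneg kk)) sum≤b)

      via : ∀ {x j y b b′} → j ∈ k ∷ S → best′ x j ≼ b → best′ j y ≼ b′ →
            best′ x y ≼ b + b′
      via (here ≡.refl) xk ky = through-k (into-k xk) (out-of-k ky) ≤-refl
      via (there j∈S) xj jy with best′-≼⁻ xj | best′-≼⁻ jy
      ... | inj₁ xj₀ | inj₁ jy₀ = keep (best-via j∈S xj₀ jy₀)
      -- Only the second half visits `k`: the old triangle inequality at `j` joins `x` to `k`, and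
      -- the new step continues from `k` to `y`. The next case is symmetric.
      ... | inj₁ xj₀ | inj₂ (_ , _ , jk , ky , sum≤b′) =
        through-k (best-via j∈S xj₀ jk) ky
          (≤-trans (≤-reflexive (+-assoc _ _ _)) (+-monoʳ-≤ _ sum≤b′))
      ... | inj₂ (_ , _ , xk , kj , sum≤b) | inj₁ jy₀ =
        through-k xk (best-via j∈S kj jy₀)
          (≤-trans (≤-reflexive (sym (+-assoc _ _ _))) (+-monoˡ-≤ _ sum≤b))
      -- Both halves visit `k`, so the detour from `k` to `j` and back to `k` is dropped, at no
      -- extra length.
      ... | inj₂ (_ , _ , xk , kj , sum≤b) | inj₂ (_ , _ , jk , ky , sum≤b′) =
        through-k xk ky
          (+-mono-≤ (≤-trans (x≤x+y _ (≼-nonneg kj)) sum≤b)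
                    (≤-trans (x≤y+x _ (≼-nonneg jk)) sum≤b′))

    floydWarshall : ∀ S → Stage S
    floydWarshall []      = initial
    floydWarshall (k ∷ S) = step k (floydWarshall S)

    open Stage (floydWarshall vertices) using (best-ε; best-edge; best-via)
      renaming (best to shortest)

    -- After all vertices are processed the triangle inequality holds through every vertex, so a
    -- path can be consumed edge by edge, splitting at its second vertex.
    shortest-≼ : ∀ {x y} (p : Star E x y) → shortest x y ≼ length p
    shortest-≼ ε       = best-ε _
    shortest-≼ (e ◅ p) = best-via (∈-vertices _) (best-edge e) (shortest-≼ p)

    shortestLength : ∀ x y → Carrier ⁺
    shortestLength x y = Maybe.map length (shortest x y)

    shortestLength-isMinimum : ∀ x y →
      IsMinimum (λ (p : Star E x y) → [ length p ]) (shortestLength x y)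
    shortestLength-isMinimum x y =
      Minimum.finite-isMinimum R (λ p → bound (shortest-≼ p)) (attained (shortest x y))
      where
      open Minimum R
      bound : ∀ {m : Maybe (Star E x y)} {b} → m ≼ b → Maybe.map length m ≤⁺ [ b ]
      bound (just p≤b) = [ p≤b ]

      attained : (m : Maybe (Star E x y)) →
                 Maybe.map length m ≡ ⊤⁺ ⊎ (∃[ p ] [ length p ] ≤⁺ Maybe.map length m)
      attained nothing  = inj₁ ≡.refl
      attained (just p) = inj₂ (p , ≤⁺-refl)

-- Arithmetic of timestamps and of their indices in the window.

module WindowProperties (W : Window) where

  open Window W
  private
    module ℤ+ = GroupProperties (AbelianGroup.group ℤ.+-0-abelianGroup)

  time-≤⇒toℕ-≤ : ∀ s t → time s ℤ.≤ time t → toℕ s ℕ.≤ toℕ t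
  time-≤⇒toℕ-≤ s t s≤t = ℤ.drop‿+≤+
    (≡.subst₂ ℤ._≤_ (ℤ+.\\-leftDividesʳ start (ℤ.+ toℕ s)) (ℤ+.\\-leftDividesʳ start (ℤ.+ toℕ t))
      (ℤ.+-monoʳ-≤ (ℤ.- start) s≤t))

  toℕ-≤⇒time-≤ : ∀ s t → toℕ s ℕ.≤ toℕ t → time s ℤ.≤ time t
  toℕ-≤⇒time-≤ s t s≤t = ℤ.+-monoʳ-≤ start (ℤ.+≤+ s≤t)

  time-+ : ∀ s t k → toℕ t ≡ k ℕ.+ toℕ s → time t ≡ ℤ.+ k ℤ.+ time s
  time-+ s t k t≡k+s = begin
    start ℤ.+ ℤ.+ toℕ t              ≡⟨ ≡.cong (λ j → start ℤ.+ ℤ.+ j) t≡k+s ⟩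
    start ℤ.+ (ℤ.+ k ℤ.+ ℤ.+ toℕ s)  ≡⟨ ℤ.+-assoc start (ℤ.+ k) _ ⟨
    (start ℤ.+ ℤ.+ k) ℤ.+ ℤ.+ toℕ s  ≡⟨ ≡.cong (ℤ._+ ℤ.+ toℕ s) (ℤ.+-comm start (ℤ.+ k)) ⟩
    (ℤ.+ k ℤ.+ start) ℤ.+ ℤ.+ toℕ s  ≡⟨ ℤ.+-assoc (ℤ.+ k) start _ ⟩
    ℤ.+ k ℤ.+ time s                 ∎
    where open ≡-Reasoning

  time-suc⁻ : ∀ s t → time t ≡ time s ℤ.+ ℤ.1ℤ → toℕ t ≡ suc (toℕ s)
  time-suc⁻ s t eq = ≡.trans
    (ℤ.+-injective (ℤ+.∙-cancelˡ start _ _ (≡.trans eq (ℤ.+-assoc start _ _))))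
    (ℕ.+-comm (toℕ s) 1)

  time-suc : ∀ s t → toℕ t ≡ suc (toℕ s) → time t ≡ time s ℤ.+ ℤ.1ℤ
  time-suc s t eq = ≡.trans (time-+ s t 1 eq) (ℤ.+-comm ℤ.1ℤ (time s))

  -- The offset `start` cancels. The difference takes the form of a nonnegative integer literal, on
  -- which `fromℤ` computes to `fromℕ`; this makes costs comparable with counts of waits.
  elapsed : ∀ s t → toℕ s ℕ.≤ toℕ t → time t ℤ.- time s ≡ ℤ.+ (toℕ t ℕ.∸ toℕ s)
  elapsed s t s≤t = ≡.trans
    (≡.cong (ℤ._- time s) (time-+ s t _ (≡.sym (ℕ.m∸n+n≡m s≤t))))
    (ℤ+.//-rightDividesʳ (time s) _)

-- Translation between temporal paths and directed paths, and transfer of the minimum.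

module Correspondence {c ℓ₁ ℓ₂} (R : OrderedCommutativeRing c ℓ₁ ℓ₂) where

  open OrderedCommutativeRing R hiding (zero)
  open OrderedRingProperties R
  open PosetReasoning (TotalOrder.poset totalOrder)

  module _
    (α : Carrier) (0≤α : 0# ≤ α) (α≤1 : α ≤ 1#)
    {n : ℕ} {W : Window} (G : TemporalGraph n W) where

    open TemporalGraph G
    open Distances R α G
    open WindowProperties W

    hops : ∀ {u v s t} → TemporalPath u v s t → ℕ
    hops = ∣_∣

    -- The price of `m` moves and `k` waits. Temporal costs and lengths in the transformed graph are
    -- both measured against it.
    charge : ℕ → ℕ → Carrier
    charge m k = α * fromℕ m + (1# - α) * fromℕ k

    *-fromℕ-suc : ∀ x m → x * fromℕ (suc m) ≈ x + x * fromℕ m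
    *-fromℕ-suc x m = trans (distribˡ x 1# (fromℕ m)) (+-congʳ (*-identityʳ x))

    charge-zero : charge 0 0 ≈ 0#
    charge-zero = trans (+-cong (zeroʳ α) (zeroʳ (1# - α))) (+-identityʳ 0#)

    charge-sucˡ : ∀ m k → charge (suc m) k ≈ α + charge m k
    charge-sucˡ m k = trans (+-congʳ (*-fromℕ-suc α m)) (+-assoc _ _ _)

    charge-sucʳ : ∀ m k → charge m (suc k) ≈ (1# - α) + charge m k
    charge-sucʳ m k = begin-equality
      α * fromℕ m + (1# - α) * fromℕ (suc k)            ≈⟨ +-congˡ (*-fromℕ-suc (1# - α) k) ⟩
      α * fromℕ m + ((1# - α) + (1# - α) * fromℕ k)     ≈⟨ +-assoc _ _ _ ⟨
      (α * fromℕ m + (1# - α)) + (1# - α) * fromℕ k     ≈⟨ +-congʳ (+-comm _ _) ⟩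
      ((1# - α) + α * fromℕ m) + (1# - α) * fromℕ k     ≈⟨ +-assoc _ _ _ ⟩
      (1# - α) + charge m k                             ∎

    0≤1-α : 0# ≤ 1# - α
    0≤1-α = begin
      0#      ≈⟨ -‿inverseʳ α ⟨
      α - α   ≤⟨ +-monoˡ-≤ (- α) α≤1 ⟩
      1# - α  ∎

    charge-monoʳ : ∀ m {k k′} → k ℕ.≤ k′ → charge m k ≤ charge m k′
    charge-monoʳ m k≤k′ = go (ℕ.≤⇒≤′ k≤k′)
      where
      go : ∀ {k k′} → k ℕ.≤′ k′ → charge m k ≤ charge m k′
      go (ℕ.≤′-reflexive ≡.refl) = ≤-refl
      go {k} (ℕ.≤′-step {k′} k≤k′) = begin
        charge m k              ≤⟨ go k≤k′ ⟩
        charge m k′             ≤⟨ x≤y+x _ 0≤1-α ⟩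
        (1# - α) + charge m k′  ≈⟨ charge-sucʳ m k′ ⟨
        charge m (suc k′)       ∎

    start≤end : ∀ {u v s t} → TemporalPath u v s t → toℕ s ℕ.≤ toℕ t
    start≤end (last _)       = ℕ.≤-refl
    start≤end (cons _ r≤s p) = ℕ.≤-trans (time-≤⇒toℕ-≤ _ _ r≤s) (start≤end p)

    duration : Timestamp → Timestamp → ℕ
    duration s t = toℕ t ℕ.∸ toℕ s

    cost-charge : ∀ {u v s t} (p : TemporalPath u v s t) →
                  cost p ≡ charge (hops p) (duration s t)
    cost-charge {s = s} {t} p =
      ≡.cong (λ k → α * fromℕ (hops p) + (1# - α) * fromℤ k) (elapsed s t (start≤end p))

    -- Prepends `k` waits at `v`, one at a time, to reach back from `t` to the earlier `s`.
    delay : ∀ k {v s t y m j} → toℕ t ≡ k ℕ.+ toℕ s →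
            (p : TPath (v , t) y) → pathLength p ≈ charge m j →
            Σ (TPath (v , s) y) λ q → pathLength q ≈ charge m (k ℕ.+ j)
    delay zero t≡s p p≈ with Fin.toℕ-injective t≡s
    ... | ≡.refl = p , p≈
    delay (suc k) {v} {s} {t} {m = m} {j} t≡1+k+s p p≈ =
      let q , q≈ = delay k {s = s⁺} {m = m} t≡k+s⁺ p p≈ in
      wait v (time-suc s s⁺ s⁺≡1+s) ◅ q ,
      trans (+-congˡ q≈) (sym (charge-sucʳ m (k ℕ.+ j)))
      where
      -- The next replica exists within the window, because `s + 1` is at most the valid index `t`.
      1+s<size : suc (toℕ s) ℕ.< size
      1+s<size = ℕ.≤-<-trans
        (ℕ.≤-trans (ℕ.s≤s (ℕ.m≤n+m (toℕ s) k)) (ℕ.≤-reflexive (≡.sym t≡1+k+s)))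
        (Fin.toℕ<n t)

      s⁺ : Timestamp
      s⁺ = fromℕ< 1+s<size

      s⁺≡1+s : toℕ s⁺ ≡ suc (toℕ s)
      s⁺≡1+s = Fin.toℕ-fromℕ< 1+s<size

      t≡k+s⁺ : toℕ t ≡ k ℕ.+ toℕ s⁺
      t≡k+s⁺ = ≡.trans t≡1+k+s
        (≡.trans (≡.sym (ℕ.+-suc k (toℕ s))) (≡.cong (k ℕ.+_) (≡.sym s⁺≡1+s)))

    duration-+ : ∀ r s t → toℕ r ℕ.≤ toℕ s → toℕ s ℕ.≤ toℕ t →
                 duration r s ℕ.+ duration s t ≡ duration r t
    duration-+ r s t r≤s s≤t =
      ≡.trans (≡.sym (ℕ.+-∸-comm _ r≤s)) (≡.cong (ℕ._∸ toℕ r) (ℕ.m+[n∸m]≡n s≤t))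

    -- After each move, waits at the vertex just reached bridge the gap to the next edge. The gaps
    -- telescope by `duration-+` to the total duration, so the length is matched exactly.
    lift : ∀ {u v s t} (p : TemporalPath u v s t) →
           Σ (TPath (u , s) (v , t)) λ q → pathLength q ≈ charge (hops p) (duration s t)
    lift {t = t} (last e) = move e ◅ ε , (begin-equality
      α + 0#                   ≈⟨ +-congˡ charge-zero ⟨
      α + charge 0 0           ≈⟨ charge-sucˡ 0 0 ⟨
      charge 1 0               ≡⟨ ≡.cong (charge 1) (ℕ.n∸n≡0 (toℕ t)) ⟨
      charge 1 (duration t t)  ∎)
    lift {s = r} {t} (cons {s = s} e r≤s p) =
      let q , q≈ = lift p
          w , w≈ = delay (duration r s) {m = (hops p)}
                     (≡.sym (ℕ.m∸n+n≡m (time-≤⇒toℕ-≤ _ _ r≤s))) q q≈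
      in move e ◅ w , (begin-equality
      α + pathLength w                                       ≈⟨ +-congˡ w≈ ⟩
      α + charge (hops p) (duration r s ℕ.+ duration s t)
        ≡⟨ ≡.cong (λ k → α + charge (hops p) k) (duration-+ r s t (time-≤⇒toℕ-≤ _ _ r≤s) (start≤end p)) ⟩
      α + charge (hops p) (duration r t)                        ≈⟨ charge-sucˡ (hops p) (duration r t) ⟨
      charge (suc (hops p)) (duration r t)                      ∎)

    pathLength-nonneg : ∀ {x y} (p : TPath x y) → 0# ≤ pathLength p
    pathLength-nonneg ε       = ≤-refl
    pathLength-nonneg (e ◅ p) = +-nonneg (weight-nonneg 0≤α α≤1 e) (pathLength-nonneg p)

    -- Time is charged from s rather than from the first move at s′, so that
    -- initial waits can be peeled off one by one.
    contract : ∀ {u v s t} (q : TPath (u , s) (v , t)) → u ≡ v ⊎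
               (∃[ s′ ] ∃[ t′ ] Σ (TemporalPath u v s′ t′) λ p →
                 toℕ s ℕ.≤ toℕ s′ × charge (hops p) (duration s t′) ≤ pathLength q)
    -- A path without moves gives no temporal path, since those have at least one edge; the first
    -- alternative covers this case.
    contract ε = inj₁ ≡.refl
    contract {s = s} (wait _ {t = s₁} eq ◅ q) with contract q
    ... | inj₁ u≡v = inj₁ u≡v
    ... | inj₂ (s′ , t′ , p , s₁≤s′ , p≤q) = inj₂ (s′ , t′ , p , ℕ.<⇒≤ s<s′ , (begin
      charge (hops p) (duration s t′)                ≡⟨ ≡.cong (charge (hops p)) one-more ⟨
      charge (hops p) (suc (duration s₁ t′))         ≈⟨ charge-sucʳ (hops p) (duration s₁ t′) ⟩
      (1# - α) + charge (hops p) (duration s₁ t′)    ≤⟨ +-monoʳ-≤ _ p≤q ⟩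
      (1# - α) + pathLength q                     ∎))
      where
      s₁≡1+s : toℕ s₁ ≡ suc (toℕ s)
      s₁≡1+s = time-suc⁻ s s₁ eq

      s<s′ : toℕ s ℕ.< toℕ s′
      s<s′ = ≡.subst (ℕ._≤ toℕ s′) s₁≡1+s s₁≤s′

      one-more : suc (duration s₁ t′) ≡ duration s t′
      -- Subtraction is truncated, so the successor can be absorbed only because `s` lies strictly
      -- before `t′`.
      one-more = ≡.trans (≡.cong (λ k → suc (toℕ t′ ℕ.∸ k)) s₁≡1+s)
        (≡.sym (ℕ.+-∸-assoc 1 (ℕ.≤-trans s<s′ (start≤end p))))
    contract {s = s} (move e ◅ q) with contract q
    -- The tail already starts at a replica of the target. It is discarded, its length being
    -- nonnegative, and the single edge remains.
    ... | inj₁ ≡.refl = inj₂ (s , s , last e , ℕ.≤-refl , (begin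
      charge 1 (duration s s)  ≡⟨ ≡.cong (charge 1) (ℕ.n∸n≡0 (toℕ s)) ⟩
      charge 1 0               ≈⟨ charge-sucˡ 0 0 ⟩
      α + charge 0 0           ≈⟨ +-congˡ charge-zero ⟩
      α + 0#                   ≤⟨ +-monoʳ-≤ α (pathLength-nonneg q) ⟩
      α + pathLength q         ∎))
    -- The bound `s≤s′` carried through the recursion is exactly the ordering of timestamps that
    -- `cons` requires. The new path starts with a move at `s`, so its own bound is reflexive.
    ... | inj₂ (s′ , t′ , p , s≤s′ , p≤q) =
      inj₂ (s , t′ , cons e (toℕ-≤⇒time-≤ s s′ s≤s′) p , ℕ.≤-refl , (begin
      charge (suc (hops p)) (duration s t′)  ≈⟨ charge-sucˡ (hops p) (duration s t′) ⟩
      α + charge (hops p) (duration s t′)    ≤⟨ +-monoʳ-≤ α p≤q ⟩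
      α + pathLength q                    ∎))

    temporal⇒path : ∀ {u v s t} (p : TemporalPath u v s t) →
                    Σ (TPath (u , s) (v , t)) λ q → pathLength q ≈ cost p
    temporal⇒path p with lift p
    ... | q , q≈ = q , trans q≈ (reflexive (≡.sym (cost-charge p)))

    -- Distinct endpoints exclude the first alternative of `contract`. Starting the clock at the
    -- first move `s′` instead of `s` then drops the initial waits and can only lower the cost.
    path⇒temporal : ∀ {u v s t} → u ≢ v → (q : TPath (u , s) (v , t)) →
                    ∃[ s′ ] ∃[ t′ ] Σ (TemporalPath u v s′ t′) λ p → cost p ≤ pathLength q
    path⇒temporal {s = s} u≢v q with contract q
    ... | inj₁ u≡v = ⊥-elim (u≢v u≡v)
    ... | inj₂ (s′ , t′ , p , s≤s′ , p≤q) = s′ , t′ , p , (begin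
      cost p                         ≡⟨ cost-charge p ⟩
      charge (hops p) (duration s′ t′)  ≤⟨ charge-monoʳ (hops p) (ℕ.∸-monoʳ-≤ (toℕ t′) s≤s′) ⟩
      charge (hops p) (duration s t′)   ≤⟨ p≤q ⟩
      pathLength q                   ∎)

    -- A wait keeps the vertex while a move changes it, by irreflexivity. So all edges between two
    -- given replicas are of one kind and equal weight, and only the existence of an edge has to be
    -- decided.
    lightestEdge : ∀ x y →
      (Σ (TEdge x y) λ e → ∀ (e′ : TEdge x y) → weight e ≤ weight e′) ⊎ ¬ TEdge x y
    lightestEdge (u , s) (v , t) with u Fin.≟ v
    ... | yes ≡.refl with time t ℤ.≟ time s ℤ.+ ℤ.1ℤ
    ...   | yes eq = inj₁ (wait u eq , λ where
              (wait _ _) → ≤-refl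
              (move e)   → ⊥-elim (irreflexive e))
    ...   | no neq = inj₂ λ where
              (wait _ eq) → neq eq
              (move e)    → irreflexive e
    lightestEdge (u , s) (v , t) | no u≢v with s Fin.≟ t
    ...   | no s≢t = inj₂ λ where
              (wait _ _) → u≢v ≡.refl
              (move _)   → s≢t ≡.refl
    ...   | yes ≡.refl with edge? u v s
    ...     | yes e = inj₁ (move e , λ where
                (wait _ _) → ⊥-elim (u≢v ≡.refl)
                (move _)   → ≤-refl)
    ...     | no ¬e = inj₂ λ where
                (wait _ _) → u≢v ≡.refl
                (move e)   → ¬e e

    private
      module SP = ShortestPaths.FloydWarshall R (≡-dec Fin._≟_ Fin._≟_)
        weight (weight-nonneg 0≤α α≤1)
        lightestEdge (cartesianProduct (allFin n) (allFin size))
        (λ (v , t) → ∈-cartesianProduct⁺ (∈-allFin v) (∈-allFin t))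

    length≡pathLength : ∀ {x y} (p : TPath x y) → SP.length p ≡ pathLength p
    length≡pathLength ε       = ≡.refl
    length≡pathLength (e ◅ p) = ≡.cong (weight e +_) (length≡pathLength p)

    shortestPathLength : ∀ x y → ∃[ m ] IsShortestPathLength x y m
    shortestPathLength x y = SP.shortestLength x y , record
      { lowerBound = λ p → ≡.subst (λ l → _ ≤⁺ [ l ]) (length≡pathLength p) (lowerBound p)
      ; attained   = [ (λ (p , eq) → inj₁ (p , ≡.subst (λ l → [ l ] ≈⁺ _) (length≡pathLength p) eq))
                     , inj₂ ]′ attained
      }
      where open IsMinimum (SP.shortestLength-isMinimum x y)

    replicaDistance : ∀ u v → ∃[ d ] IsReplicaDistance u v d
    replicaDistance u v =
      let m s t     = shortestPathLength (u , s) (v , t)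
          d , isMin = Minimum.finiteMinimum₂ R (λ (s , t) → proj₁ (m s t))
      in d , (λ s t → proj₁ (m s t)) , (λ s t → proj₂ (m s t)) , isMin

    -- Temporal paths may be infinitely many, as edges of one timestamp can be traversed back and
    -- forth, so their minimum is transferred rather than searched for. Lifting gives the lower
    -- bound, and contracting a shortest directed path gives a temporal path attaining it.
    replicaDistance⇒temporalDistance : ∀ {u v d} → u ≢ v →
      IsReplicaDistance u v d → IsShortestFastestDistance u v d
    replicaDistance⇒temporalDistance {u} {v} {d} u≢v (m , shortest , isMin) =
      finite-isMinimum below (attained′ attained)
      where
      open Minimum R
      open IsMinimum isMin

      below : ((s , t , p) : ∃[ s ] ∃[ t ] TemporalPath u v s t) → d ≤⁺ [ cost p ]
      below (s , t , p) with temporal⇒path p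
      ... | q , q≈p = ≤⁺-trans (lowerBound (s , t))
        (≤⁺-trans (IsMinimum.lowerBound (shortest s t) q) [ ≤-reflexive q≈p ])

      ≈⁺⇒≤⁺ : ∀ {x y} → x ≈⁺ y → x ≤⁺ y
      ≈⁺⇒≤⁺ = SupOrder.≤⁺-reflexive _≤_ ≤-reflexive

      ⊤≈⇒≡⊤ : ∀ {x y} → x ≈⁺ y → x ≡ ⊤⁺ → y ≡ ⊤⁺
      ⊤≈⇒≡⊤ SupEquality.⊤⁺≈⊤⁺ _ = ≡.refl

      attained′ : (∃[ i ] uncurry m i ≈⁺ d) ⊎ (¬ (Timestamp × Timestamp) × d ≡ ⊤⁺) →
                  d ≡ ⊤⁺ ⊎ (∃[ (_ , _ , p) ] [ cost p ] ≤⁺ d)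
      -- Here the window is empty; below, an infinite inner minimum is another source of `⊤⁺`. In
      -- both cases `finite-isMinimum` deduces from the lower bound that no temporal path exists.
      attained′ (inj₂ (_ , d≡⊤)) = inj₁ d≡⊤
      attained′ (inj₁ ((s , t) , mst≈d)) with IsMinimum.attained (shortest s t)
      ... | inj₂ (_ , mst≡⊤) = inj₁ (⊤≈⇒≡⊤ mst≈d mst≡⊤)
      ... | inj₁ (q , q≈mst) with path⇒temporal u≢v q
      ...   | s′ , t′ , p , p≤q = inj₂ ((s′ , t′ , p) ,
              ≤⁺-trans [ p≤q ] (≤⁺-trans (≈⁺⇒≤⁺ q≈mst) (≈⁺⇒≤⁺ mst≈d)))

mainTheorem2 : ∀ {c ℓ₁ ℓ₂} (R : OrderedCommutativeRing c ℓ₁ ℓ₂) →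
    let open OrderedCommutativeRing R in
    (α : Carrier) → 0# ≤ α → α ≤ 1# →
    (n : ℕ) (W : Window) (G : TemporalGraph n W) →
    let open Distances R α G in
    (u v : Fin n) → u ≢ v →
    ∃[ d ] (IsShortestFastestDistance u v d × IsReplicaDistance u v d)
mainTheorem2 R α 0≤α α≤1 n W G u v u≢v =
  let d , isReplicaDistance = replicaDistance α 0≤α α≤1 G u v
  in d , replicaDistance⇒temporalDistance α 0≤α α≤1 G u≢v isReplicaDistance , isReplicaDistance
  where open Correspondence R
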